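{- Almost all tournaments are path extendable; that is, if $T_n$ denotes a tournament on $n$ labelled vertices chosen uniformly at random (each pair $\{u,v\}$ independently oriented as $uv$ or $vu$ with probability $1/2$ each), then the probability that $T_n$ is path extendable tends to $1$ as $n\to\infty$.
   Context: All paths are directed paths. A path $P$ in a digraph $D$ that is not hamiltonian is called extendable if there is a path $P'$ with the same initial and the same terminal vertex as $P$ and $V(P')=V(P)\cup\{w\}$ for some vertex $w\in V(D)\setminus V(P)$. A digraph is path extendable if every nonhamiltonian path of length at least $1$ in it is extendable. -}

module Defs where

open import Data.Nat using (ℕ; zero; suc; _≤_; _*_; _∸_)
open import Data.Fin using (Fin; zero; suc)
open import Data.Bool using (Bool; true; false; T)
open import Data.Unit using (⊤; tt)
open import Data.Empty using (⊥)
open import Data.Product using (Σ; ∃; _×_; _,_)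
open import Data.Sum using (_⊎_)
open import Data.Vec using (Vec; []; _∷_; lookup)
open import Data.List using (List; []; _∷_; length; head; last; filterᵇ; cartesianProduct; concatMap)
open import Data.List.Membership.Propositional using (_∈_; _∉_)
open import Data.List.Relation.Unary.Unique.Propositional using (Unique)
open import Data.List.Relation.Unary.Linked using (Linked)
open import Relation.Binary.PropositionalEquality using (_≡_)
open import Relation.Nullary using (¬_)
open import Function.Bundles using (_⇔_)

Digraph : ℕ → Set₁
Digraph n = Fin n → Fin n → Set

IsPath : ∀ {n} → Digraph n → List (Fin n) → Set
IsPath A P = Unique P × Linked A P

Extendable : ∀ {n} → Digraph n → List (Fin n) → Set
Extendable {n} A P =
  Σ (Fin n) λ w → w ∉ P ×
    Σ (List (Fin n)) λ P' → IsPath A P' × head P' ≡ head P × last P' ≡ last P ×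
      (∀ v → (v ∈ P') ⇔ (v ∈ P ⊎ v ≡ w))

-- Every nonhamiltonian path of length at least 1 (≥ 2 vertices) is extendable.
PathExtendable : ∀ {n} → Digraph n → Set
PathExtendable {n} A =
  ∀ (P : List (Fin n)) → IsPath A P → 2 ≤ length P →
    (Σ (Fin n) λ v → v ∉ P) → Extendable A P

-- Labelled tournaments on Fin n, encoded bijectively:
-- a tournament on Fin (suc n) is a tournament on the vertices suc i (i : Fin n)
-- together with, for each old vertex j, the orientation of the edge {0, suc j}
-- (true : 0 → suc j, false : suc j → 0).  There are exactly 2^(n choose 2) of them.

Tour : ℕ → Set
Tour zero    = ⊤
Tour (suc n) = Tour n × Vec Bool n

arc : ∀ {n} → Tour n → Digraph n
arc {suc n} (t , v) zero    zero    = ⊥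
arc {suc n} (t , v) zero    (suc j) = T (lookup v j)
arc {suc n} (t , v) (suc i) zero    = lookup v i ≡ false
arc {suc n} (t , v) (suc i) (suc j) = arc t i j

allVecs : (n : ℕ) → List (Vec Bool n)
allVecs zero    = [] ∷ []
allVecs (suc n) = concatMap (λ v → (true ∷ v) ∷ (false ∷ v) ∷ []) (allVecs n)

-- All labelled tournaments on Fin n, each exactly once (uniform sample space).
allTours : (n : ℕ) → List (Tour n)
allTours zero    = tt ∷ []
allTours (suc n) = cartesianProduct (allTours n) (allVecs n)

total : ℕ → ℕ
total n = length (allTours n)

countSel : ∀ n → (Tour n → Bool) → ℕ
countSel n sel = length (filterᵇ sel (allTours n))

{-# OPTIONS --safe #-}

-- Put s ≈ log n. With high probability a random tournament has two properties: for all x ≠ y and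
-- any 2s vertices there is some x → z → y avoiding these vertices, and for any s disjoint pairs
-- (x , y) and any s further vertices, one of the latter satisfies x → z → y for one of the pairs.
-- Each fails by a union bound: the edges involved are distinct, so a configuration of at least
-- s² triples (x , z , y) contains no path x → z → y with probability at most (3/4)^(s²).
-- Now let P be a nonhamiltonian path. If P has at most 2s vertices, or leaves out at least s, then
-- some outside vertex can be inserted between two consecutive vertices of P. Otherwise take w
-- outside P. If w cannot be inserted, P = A B with w → A and B → w; for the last vertex a of A and
-- the first vertex b of B choose w → z₁ → b and a → z₂ → w on P. Then P = A₁ z₁ A₂ a b B₁ z₂ B₂
-- is extended by A₁ z₁ b B₁ w A₂ a z₂ B₂.
module Submission where

open import Defs
open import Data.Nat using (ℕ; zero; suc; _+_; _*_; _∸_; _^_; _≤_; _<_; z≤n; s≤s; ⌊_/2⌋; _≤?_; _<?_; >-nonZero)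
open import Data.Nat.Properties
open import Data.Nat.ListAction using (sum)
open import Data.Nat.ListAction.Properties using (sum-++)
open import Data.Nat.Solver using (module +-*-Solver)
open import Data.Bool using (Bool; true; false; not; _∧_)
open import Data.Bool.Properties using (T-≡; ∧-assoc)
open import Data.Fin using (Fin; zero; suc) renaming (_≟_ to _≟ᶠ_)
open import Data.Product using (Σ; ∃; ∃₂; _×_; _,_; proj₁; proj₂; uncurry)
open import Data.Sum using (_⊎_; inj₁; inj₂)
open import Data.Vec using (Vec; []; _∷_; lookup; updateAt)
open import Data.Vec.Properties using (lookup∘updateAt; lookup∘updateAt′)
open import Data.List using (List; []; _∷_; _++_; _∷ʳ_; length; head; last; map; filter; filterᵇ; allFin; take; drop; replicate; concatMap; cartesianProductWith; initLast; InitLast; _∷ʳ′_)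
open import Data.List.Properties using (++-assoc; ∷ʳ-++; map-++; map-∘; map-cong; length-++; length-map; length-filter; length-take; length-replicate; length-tabulate; take++drop≡id)
open import Data.List.Membership.Propositional using (_∈_; _∉_)
open import Data.List.Membership.Propositional.Properties using (∈-++⁺ˡ; ∈-++⁺ʳ; ∈-++⁻; ∈-∃++; ∈-filter⁺; ∈-filter⁻; ∈-allFin; ∈-map⁺; ∈-cartesianProductWith⁺; ∈-cartesianProductWith⁻)
import Data.List.Membership.DecPropositional as DecMembership
open import Data.List.Relation.Unary.Any using (here; there)
open import Data.List.Relation.Unary.All as All using (All; []; _∷_; all?)
import Data.List.Relation.Unary.All.Properties as All
open import Data.List.Relation.Unary.AllPairs as AllPairs using (AllPairs; []; _∷_)
import Data.List.Relation.Unary.AllPairs.Properties as AllPairs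
open import Data.List.Relation.Unary.Linked using (Linked; []; [-]; _∷_)
open import Data.List.Relation.Unary.Unique.Propositional using (Unique)
import Data.List.Relation.Unary.Unique.Propositional.Properties as Unique
import Data.List.Relation.Unary.Unique.DecPropositional as DecUnique
open import Data.List.Relation.Binary.Permutation.Propositional using (_↭_; ↭-refl; ↭-sym; ↭-trans; ↭-reflexive; ↭⇒↭ₛ; prep; swap)
open import Data.List.Relation.Binary.Permutation.Propositional.Properties using (shift; shifts; ++⁺ˡ; ∈-resp-↭)
import Data.List.Relation.Binary.Permutation.Setoid.Properties as ↭ₛ
open import Relation.Binary.PropositionalEquality
open import Relation.Nullary using (¬_; Dec; yes; no; contradiction)
open import Relation.Nullary.Decidable using (_×-dec_; from-yes)
open import Function using (_∘_)
open import Function.Bundles using (mk⇔; Equivalence)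

private
  variable
    X Y Z : Set
    n : ℕ

-- Extending paths in a tournament with detours and insertions

Linked-split : ∀ {R : X → X → Set} xs {y ys} → Linked R (xs ++ y ∷ ys) →
               Linked R (xs ∷ʳ y) × Linked R (y ∷ ys)
Linked-split []            l       = [-] , l
Linked-split (x ∷ [])      (r ∷ l) = r ∷ [-] , l
Linked-split (x ∷ x′ ∷ xs) (r ∷ l) with Linked-split (x′ ∷ xs) l
... | l₁ , l₂ = r ∷ l₁ , l₂

Linked-join : ∀ {R : X → X → Set} xs {y ys} → Linked R (xs ∷ʳ y) → Linked R (y ∷ ys) →
              Linked R (xs ++ y ∷ ys)
Linked-join []            l₁       l₂ = l₂
Linked-join (x ∷ [])      (r ∷ l₁) l₂ = r ∷ l₂
Linked-join (x ∷ x′ ∷ xs) (r ∷ l₁) l₂ = r ∷ Linked-join (x′ ∷ xs) l₁ l₂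

Linked-replaceLast : ∀ {R : X → X → Set} xs {y z} → Linked R (xs ∷ʳ y) → All (λ x → R x z) xs →
                     Linked R (xs ∷ʳ z)
Linked-replaceLast []            l       rs       = [-]
Linked-replaceLast (x ∷ [])      l       (r ∷ rs) = r ∷ [-]
Linked-replaceLast (x ∷ x′ ∷ xs) (r ∷ l) (_ ∷ rs) = r ∷ Linked-replaceLast (x′ ∷ xs) l rs

Linked-replaceHead : ∀ {R : X → X → Set} {x y xs} → Linked R (x ∷ xs) → All (R y) xs → Linked R (y ∷ xs)
Linked-replaceHead [-]     []      = [-]
Linked-replaceHead (_ ∷ l) (r ∷ _) = r ∷ l

head-++ : ∀ (xs : List X) {y ys zs} → head (xs ++ y ∷ ys) ≡ head (xs ++ y ∷ zs)
head-++ []       = refl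
head-++ (x ∷ xs) = refl

last-++ : ∀ (xs : List X) {y ys} → last (xs ++ y ∷ ys) ≡ last (y ∷ ys)
last-++ []            = refl
last-++ (x ∷ [])      = refl
last-++ (x ∷ x′ ∷ xs) = last-++ (x′ ∷ xs)

Unique-resp-↭ : ∀ {xs ys : List X} → xs ↭ ys → Unique xs → Unique ys
Unique-resp-↭ p = ↭ₛ.Unique-resp-↭ (setoid _) (↭⇒↭ₛ p)

-- Disjoint blocks of two, not all consecutive pairs: in a list without repetitions different blocks
-- share no vertex, so triples with a common middle vertex use distinct edges. Each block still
-- consists of neighbouring entries.
pairs : List X → List (X × X)
pairs []           = []
pairs (x ∷ [])     = []
pairs (x ∷ y ∷ xs) = (x , y) ∷ pairs xs

∈-pairs⁻ : ∀ (xs : List X) {x y} → (x , y) ∈ pairs xs → ∃₂ λ ys zs → xs ≡ ys ++ x ∷ y ∷ zs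
∈-pairs⁻ (x ∷ y ∷ xs) (here refl) = [] , xs , refl
∈-pairs⁻ (x ∷ y ∷ xs) (there p) with ∈-pairs⁻ xs p
... | ys , zs , refl = x ∷ y ∷ ys , zs , refl

infix 4 _∈?_ _∉?_

_∈?_ : (v : Fin n) (xs : List (Fin n)) → Dec (v ∈ xs)
_∈?_ = DecMembership._∈?_ _≟ᶠ_

_∉?_ : (v : Fin n) (xs : List (Fin n)) → Dec (v ∉ xs)
_∉?_ = DecMembership._∉?_ _≟ᶠ_

others : List (Fin n) → List (Fin n)
others xs = filter (_∉? xs) (allFin _)

∈-others⁺ : ∀ {xs} {v : Fin n} → v ∉ xs → v ∈ others xs
∈-others⁺ v∉ = ∈-filter⁺ _ (∈-allFin _) v∉

∈-others⁻ : ∀ {xs} {v : Fin n} → v ∈ others xs → v ∉ xs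
∈-others⁻ {xs = xs} v∈ = proj₂ (∈-filter⁻ (_∉? xs) {xs = allFin _} v∈)

∉-others⁻ : ∀ {xs} {v : Fin n} → v ∉ others xs → v ∈ xs
∉-others⁻ {xs = xs} {v} v∉ with v ∈? xs
... | yes v∈ = v∈
... | no  v∉′ = contradiction (∈-others⁺ v∉′) v∉

others-Unique : ∀ (xs : List (Fin n)) → Unique (others xs)
others-Unique xs = Unique.filter⁺ (_∉? xs) (Unique.allFin⁺ _)

length-take-≤ : ∀ {m} (xs : List X) → m ≤ length xs → length (take m xs) ≡ m
length-take-≤ xs m≤ = trans (length-take _ xs) (m≤n⇒m⊓n≡m m≤)

∈-take : ∀ m {xs : List X} {v} → v ∈ take m xs → v ∈ xs
∈-take m {xs} v∈ = subst (_ ∈_) (take++drop≡id m xs) (∈-++⁺ˡ v∈)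

module _ (A : Digraph n) where

  HasDetours : ℕ → Set
  HasDetours t = ∀ {x y} Z → x ≢ y → length Z ≤ t → ∃ λ z → z ∉ Z × A x z × A z y

  HasInsertions : ℕ → ℕ → Set
  HasInsertions t s = ∀ L S → length L ≡ t → length S ≡ s → Unique L → Unique S → All (_∉ L) S →
    ∃ λ z → z ∈ S × ∃₂ λ x y → (x , y) ∈ pairs L × A x z × A z y

  -- The permutation yields both the uniqueness and the vertex set of `P′`, so only arcs and end
  -- vertices remain to be checked for each construction.
  extend-↭ : ∀ {P P′ w} → Unique P → w ∉ P → Linked A P′ → P′ ↭ w ∷ P →
             head P′ ≡ head P → last P′ ≡ last P → Extendable A P
  extend-↭ {P} {P′} {w} uniq w∉P linked p eqₕ eqₗ =
    w , w∉P , P′ , (Unique-resp-↭ (↭-sym p) (All.tabulate (λ { v∈ refl → w∉P v∈ }) ∷ uniq) , linked) ,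
    eqₕ , eqₗ , λ v → mk⇔ (to ∘ ∈-resp-↭ p) (∈-resp-↭ (↭-sym p) ∘ from)
    where
    to : ∀ {v} → v ∈ w ∷ P → v ∈ P ⊎ v ≡ w
    to (here eq)  = inj₂ eq
    to (there v∈) = inj₁ v∈
    from : ∀ {v} → v ∈ P ⊎ v ≡ w → v ∈ w ∷ P
    from (inj₁ v∈) = there v∈
    from (inj₂ eq) = here eq

  extend-insert : ∀ {P} Q {x y R w} → P ≡ Q ++ x ∷ y ∷ R → IsPath A P → w ∉ P →
                  A x w → A w y → Extendable A P
  extend-insert Q {x} {y} {R} {w} refl (uniq , linked) w∉ xw wy with Linked-split Q linked
  ... | l , _ ∷ l′ = extend-↭ uniq w∉ (Linked-join Q l (xw ∷ wy ∷ l′))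
    (↭-trans (++⁺ˡ Q (swap x w ↭-refl)) (shift w Q (x ∷ y ∷ R)))
    (head-++ Q) (trans (last-++ Q) (sym (last-++ Q)))

  -- Since `A₂` and `B₁` may be empty, `w` is entered from the last vertex of `b ∷ B₁` and left
  -- towards the first vertex of `A₂ ∷ʳ a`. The other new arcs are `z₁b` and `az₂`.
  extend-rotate : ∀ {P} A₁ {z₁} A₂ {a b} B₁ {z₂} B₂ {w} →
    P ≡ A₁ ++ z₁ ∷ A₂ ++ a ∷ b ∷ B₁ ++ z₂ ∷ B₂ → IsPath A P → w ∉ P →
    All (A w) (A₂ ∷ʳ a) → All (λ u → A u w) (b ∷ B₁) → A z₁ b → A a z₂ → Extendable A P
  extend-rotate A₁ {z₁} A₂ {a} {b} B₁ {z₂} B₂ {w} refl (uniq , linked) w∉ wA Bw z₁b az₂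
    with Linked-split A₁ linked
  ... | l₁ , r₁ with Linked-split (z₁ ∷ A₂) r₁
  ... | l₂ , _ ∷ r₂ with Linked-split (b ∷ B₁) r₂
  ... | l₃ , r₃ = extend-↭ uniq w∉
    -- `l₃` is the segment `b B₁ z₂` and `l₂` is `z₁ A₂ a`. Writing `w` for `z₂` in the first and
    -- for `z₁` in the second lets them be glued at `w`.
    (Linked-join A₁ l₁ (z₁b ∷ Linked-join (b ∷ B₁) (Linked-replaceLast (b ∷ B₁) l₃ Bw)
      (Linked-join (w ∷ A₂) (Linked-replaceHead l₂ wA) (az₂ ∷ r₃))))
    (↭-trans (++⁺ˡ A₁ (prep z₁ (↭-trans (shift w (b ∷ B₁) _) (prep w exchange))))
      (↭-trans (++⁺ˡ A₁ (swap z₁ w ↭-refl)) (shift w A₁ _)))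
    (head-++ A₁)
    (trans (trans (last-++ A₁) (trans (last-++ (z₁ ∷ b ∷ B₁)) (last-++ (w ∷ A₂))))
      (sym (trans (last-++ A₁) (trans (last-++ (z₁ ∷ A₂)) (last-++ (a ∷ b ∷ B₁))))))
    where
    exchange : (b ∷ B₁) ++ A₂ ++ a ∷ z₂ ∷ B₂ ↭ A₂ ++ a ∷ b ∷ B₁ ++ z₂ ∷ B₂
    exchange = ↭-trans (↭-reflexive (cong ((b ∷ B₁) ++_) (sym (∷ʳ-++ A₂ a _))))
      (↭-trans (shifts (b ∷ B₁) (A₂ ∷ʳ a)) (↭-reflexive (∷ʳ-++ A₂ a _)))

module _ {A : Digraph n}
  (semicomplete : ∀ {u v} → u ≢ v → A u v ⊎ A v u)
  (asym : ∀ {u v} → A u v → ¬ A v u) where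

  -- `P` is scanned from its end. A new first vertex `p` with `w → p` joins `As`. If `p → w`, then
  -- `w` fits between `p` and the first vertex of `As`, or `As` is empty and `p` joins `Bs`.
  insertable⊎threshold : ∀ P {w} → w ∉ P →
    (∃₂ λ Q x → ∃₂ λ y R → P ≡ Q ++ x ∷ y ∷ R × A x w × A w y) ⊎
    (∃₂ λ As Bs → P ≡ As ++ Bs × All (A w) As × All (λ u → A u w) Bs)
  insertable⊎threshold []      w∉ = inj₂ ([] , [] , refl , [] , [])
  insertable⊎threshold (p ∷ P) w∉ with insertable⊎threshold P (w∉ ∘ there)
  ... | inj₁ (Q , x , y , R , refl , xw , wy) = inj₁ (p ∷ Q , x , y , R , refl , xw , wy)
  ... | inj₂ (As , Bs , refl , wAs , Bsw) with semicomplete (w∉ ∘ here) | As | wAs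
  ...   | inj₁ wp | As′     | wAs′      = inj₂ (p ∷ As′ , Bs , refl , wp ∷ wAs′ , Bsw)
  ...   | inj₂ pw | []      | _         = inj₂ ([] , p ∷ Bs , refl , [] , pw ∷ Bsw)
  ...   | inj₂ pw | a ∷ As′ | wa ∷ _    = inj₁ ([] , p , a , As′ ++ Bs , refl , pw , wa)

  extend-threshold : ∀ {t} → HasDetours A t → ∀ {w} A₀ a b B₀ → let P = (A₀ ∷ʳ a) ++ b ∷ B₀ in
    IsPath A P → w ∉ P → suc (length (others P)) ≤ t →
    All (A w) (A₀ ∷ʳ a) → All (λ u → A u w) (b ∷ B₀) → Extendable A P
  extend-threshold detour {w} A₀ a b B₀ path w∉P M<t wA (bw ∷ Bw)
    -- Avoiding `M` forces `z₁` and `z₂` onto `P`, and asymmetry at `w` then puts them on the `A`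
    -- side and the `B` side. The extra avoided vertex, `a` or `b`, makes `z₁` lie strictly before
    -- `a` and `z₂` strictly after `b`.
    with detour (a ∷ M) (λ { refl → w∉P (∈-++⁺ʳ (A₀ ∷ʳ a) (here refl)) }) M<t
       | detour (b ∷ M) (λ { refl → w∉P (∈-++⁺ˡ (∈-++⁺ʳ A₀ (here refl))) }) M<t
    where M = others ((A₀ ∷ʳ a) ++ b ∷ B₀)
  ... | z₁ , z₁∉ , wz₁ , z₁b | z₂ , z₂∉ , az₂ , z₂w = rotate (∈-∃++ z₁∈) (∈-∃++ z₂∈)
    where
    P = (A₀ ∷ʳ a) ++ b ∷ B₀

    z₁∈ : z₁ ∈ A₀
    z₁∈ with ∈-++⁻ (A₀ ∷ʳ a) (∉-others⁻ (z₁∉ ∘ there))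
    ... | inj₂ z₁∈B = contradiction (All.lookup (bw ∷ Bw) z₁∈B) (asym wz₁)
    ... | inj₁ z₁∈A with ∈-++⁻ A₀ z₁∈A
    ...   | inj₁ z₁∈A₀      = z₁∈A₀
    ...   | inj₂ (here eq)  = contradiction (here eq) z₁∉

    z₂∈ : z₂ ∈ B₀
    z₂∈ with ∈-++⁻ (A₀ ∷ʳ a) (∉-others⁻ (z₂∉ ∘ there))
    ... | inj₁ z₂∈A         = contradiction (All.lookup wA z₂∈A) (asym z₂w)
    ... | inj₂ (here eq)    = contradiction (here eq) z₂∉
    ... | inj₂ (there z₂∈B) = z₂∈B

    rotate : (∃₂ λ A₁ A₂ → A₀ ≡ A₁ ++ z₁ ∷ A₂) → (∃₂ λ B₁ B₂ → B₀ ≡ B₁ ++ z₂ ∷ B₂) → Extendable A P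
    rotate (A₁ , A₂ , refl) (B₁ , B₂ , refl) = extend-rotate A A₁ A₂ B₁ B₂
      (trans (∷ʳ-++ (A₁ ++ z₁ ∷ A₂) a _) (++-assoc A₁ (z₁ ∷ A₂) _)) path w∉P
      (All.tail (All.++⁻ʳ A₁ (subst (All (A w)) (++-assoc A₁ (z₁ ∷ A₂) _) wA)))
      (bw ∷ All.++⁻ˡ B₁ Bw) z₁b az₂

  extend-few-others : ∀ {t} → HasDetours A t → ∀ {P w p} → IsPath A P → w ∉ P → p ∈ P →
    suc (length (others P)) ≤ t → Extendable A P
  extend-few-others detour {P} {w} {p} path w∉ p∈ M<t with insertable⊎threshold P w∉
  ... | inj₁ (Q , x , y , R , eq , xw , wy) = extend-insert A Q eq path w∉ xw wy
  ... | inj₂ (As , Bs , eq , wA , Bw) = go (initLast As) Bs eq wA Bw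
    where
    go : ∀ {As} → InitLast As → ∀ Bs → P ≡ As ++ Bs → All (A w) As → All (λ u → A u w) Bs → Extendable A P
    go (A₀ ∷ʳ′ a) (b ∷ B₀) refl wA Bw = extend-threshold detour A₀ a b B₀ path w∉ M<t wA Bw
    -- All of `P` dominates `w`, but a detour from `w` to `p` that avoids the outside vertices
    -- starts with an arc from `w` to a vertex of `P`. The case of empty `Bs` is dual.
    go []         Bs       refl _  Bw with detour {w} {p} (others P) (λ { refl → w∉ p∈ }) (<⇒≤ M<t)
    ... | z , z∉ , wz , _ = contradiction wz (asym (All.lookup Bw (∉-others⁻ z∉)))
    go (A₀ ∷ʳ′ a) []       refl wA _  with detour {p} {w} (others P) (λ { refl → w∉ p∈ }) (<⇒≤ M<t)
    ... | z , z∉ , _ , zw = contradiction zw (asym (All.lookup (All.++⁺ wA []) (∉-others⁻ z∉)))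

  path-extendable : ∀ {s t} → s ≤ t → HasDetours A t → HasInsertions A t s → PathExtendable A
  path-extendable {s} {t} s≤t detour insertion (_ ∷ []) _ (s≤s ()) _
  path-extendable {s} {t} s≤t detour insertion P@(x ∷ y ∷ R₀) path@(uniq , _) _ (w , w∉)
    with length P ≤? t | s ≤? length (others P)
  -- A short path can itself be the avoided list: the detour between its first two vertices then
  -- leaves `P`.
  ... | yes P≤t | _ with detour P (All.head (AllPairs.head uniq)) P≤t
  ...   | z , z∉ , xz , zy = extend-insert A [] refl path z∉ xz zy
  path-extendable {s} {t} s≤t detour insertion P@(_ ∷ _ ∷ _) path@(uniq , _) _ (w , w∉) | no P≰t | yes s≤M
    -- Blocks of a prefix of `P` are consecutive on `P`, so a vertex joining such a block can be
    -- inserted there.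
    with insertion (take t P) (take s (others P)) (length-take-≤ P (<⇒≤ (≰⇒> P≰t)))
      (length-take-≤ (others P) s≤M)
      (Unique.take⁺ t uniq) (Unique.take⁺ s (others-Unique P))
      (All.tabulate (λ v∈M v∈P → ∈-others⁻ (∈-take s v∈M) (∈-take t v∈P)))
  ... | z , z∈ , x , y , xy∈ , xz , zy with ∈-pairs⁻ (take t P) xy∈
  ...   | Q , R , eq = extend-insert A Q P≡ path (∈-others⁻ (∈-take s z∈)) xz zy
    where
    P≡ : P ≡ Q ++ x ∷ y ∷ R ++ drop t P
    P≡ = trans (sym (take++drop≡id t P)) (trans (cong (_++ drop t P) eq) (++-assoc Q (x ∷ y ∷ R) (drop t P)))
  path-extendable s≤t detour insertion (_ ∷ _ ∷ _) path _ (w , w∉) | no _ | no s≰M =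
    -- Fewer than `s` vertices are outside, so their list with one more vertex has length at most
    -- `s ≤ t`.
    extend-few-others detour path w∉ (here refl) (≤-trans (≰⇒> s≰M) s≤t)

-- Counting tournaments by flipping edges

-- A Boolean form of `arc` for counting. Both orientations of a pair read the same bit; the diagonal
-- has the default value `false`.
edge : Tour n → Fin n → Fin n → Bool
edge {suc n} (t , v) zero    zero    = false
edge {suc n} (t , v) zero    (suc j) = lookup v j
edge {suc n} (t , v) (suc i) zero    = not (lookup v i)
edge {suc n} (t , v) (suc i) (suc j) = edge t i j

edge⇒arc : ∀ (t : Tour n) i j → edge t i j ≡ true → arc t i j
edge⇒arc {suc n} (t , v) zero    (suc j) e = Equivalence.from T-≡ e
edge⇒arc {suc n} (t , v) (suc i) zero    e with lookup v i
... | false = refl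
edge⇒arc {suc n} (t , v) (suc i) (suc j) e = edge⇒arc t i j e

arc-semicomplete : ∀ (t : Tour n) {i j} → i ≢ j → arc t i j ⊎ arc t j i
arc-semicomplete {suc n} (t , v) {zero}  {zero}  i≢j = contradiction refl i≢j
arc-semicomplete {suc n} (t , v) {zero}  {suc j} i≢j with lookup v j
... | true  = inj₁ _
... | false = inj₂ refl
arc-semicomplete {suc n} (t , v) {suc i} {zero}  i≢j with lookup v i
... | true  = inj₂ _
... | false = inj₁ refl
arc-semicomplete {suc n} (t , v) {suc i} {suc j} i≢j = arc-semicomplete t (i≢j ∘ cong suc)

arc-asym : ∀ (t : Tour n) {i j} → arc t i j → ¬ arc t j i
arc-asym {suc n} (t , v) {zero}  {suc j} a b rewrite b = a
arc-asym {suc n} (t , v) {suc i} {zero}  a b rewrite a = b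
arc-asym {suc n} (t , v) {suc i} {suc j} a b = arc-asym t a b

-- A measure-preserving involution of the sample space. Invariance of an event under it replaces
-- independence of that edge.
flipEdge : Fin n → Fin n → Tour n → Tour n
flipEdge zero    zero    t       = t
flipEdge zero    (suc j) (t , v) = t , updateAt v j not
flipEdge (suc i) zero    (t , v) = t , updateAt v i not
flipEdge (suc i) (suc j) (t , v) = flipEdge i j t , v

edge-flipEdge : ∀ (t : Tour n) {i j} → i ≢ j → edge (flipEdge i j t) i j ≡ not (edge t i j)
edge-flipEdge {suc n} (t , v) {zero}  {zero}  i≢j = contradiction refl i≢j
edge-flipEdge {suc n} (t , v) {zero}  {suc j} i≢j = lookup∘updateAt j v
edge-flipEdge {suc n} (t , v) {suc i} {zero}  i≢j = cong not (lookup∘updateAt i v)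
edge-flipEdge {suc n} (t , v) {suc i} {suc j} i≢j = edge-flipEdge t (i≢j ∘ cong suc)

DistinctEdges : (i j a b : Fin n) → Set
DistinctEdges i j a b = ¬ (a ≡ i × b ≡ j) × ¬ (a ≡ j × b ≡ i)

edge-flipEdge-minimal : ∀ (t : Tour n) {i j a b} → DistinctEdges i j a b →
                        edge (flipEdge i j t) a b ≡ edge t a b
edge-flipEdge-minimal {suc n} (t , v) {zero}  {zero}  _ = refl
edge-flipEdge-minimal {suc n} (t , v) {zero}  {suc j} {zero}  {zero}  _ = refl
edge-flipEdge-minimal {suc n} (t , v) {zero}  {suc j} {zero}  {suc b} (d , _) =
  lookup∘updateAt′ b j (λ { refl → d (refl , refl) }) v
edge-flipEdge-minimal {suc n} (t , v) {zero}  {suc j} {suc a} {zero}  (_ , d) =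
  cong not (lookup∘updateAt′ a j (λ { refl → d (refl , refl) }) v)
edge-flipEdge-minimal {suc n} (t , v) {zero}  {suc j} {suc a} {suc b} _ = refl
edge-flipEdge-minimal {suc n} (t , v) {suc i} {zero}  {zero}  {zero}  _ = refl
edge-flipEdge-minimal {suc n} (t , v) {suc i} {zero}  {zero}  {suc b} (_ , d) =
  lookup∘updateAt′ b i (λ { refl → d (refl , refl) }) v
edge-flipEdge-minimal {suc n} (t , v) {suc i} {zero}  {suc a} {zero}  (d , _) =
  cong not (lookup∘updateAt′ a i (λ { refl → d (refl , refl) }) v)
edge-flipEdge-minimal {suc n} (t , v) {suc i} {zero}  {suc a} {suc b} _ = refl
edge-flipEdge-minimal {suc n} (t , v) {suc i} {suc j} {zero}  {zero}  _ = refl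
edge-flipEdge-minimal {suc n} (t , v) {suc i} {suc j} {zero}  {suc b} _ = refl
edge-flipEdge-minimal {suc n} (t , v) {suc i} {suc j} {suc a} {zero}  _ = refl
edge-flipEdge-minimal {suc n} (t , v) {suc i} {suc j} {suc a} {suc b} (d₁ , d₂) =
  edge-flipEdge-minimal t ((λ { (refl , refl) → d₁ (refl , refl) }) , λ { (refl , refl) → d₂ (refl , refl) })

∑ : List X → (X → ℕ) → ℕ
∑ xs f = sum (map f xs)

∑-cong : ∀ (xs : List X) {f g : X → ℕ} → (∀ x → f x ≡ g x) → ∑ xs f ≡ ∑ xs g
∑-cong xs eq = cong sum (map-cong eq xs)

∑-++ : ∀ (xs ys : List X) (f : X → ℕ) → ∑ (xs ++ ys) f ≡ ∑ xs f + ∑ ys f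
∑-++ xs ys f = trans (cong sum (map-++ f xs ys)) (sum-++ (map f xs) (map f ys))

∑-+ : ∀ (xs : List X) (f g : X → ℕ) → ∑ xs (λ x → f x + g x) ≡ ∑ xs f + ∑ xs g
∑-+ []       f g = refl
∑-+ (x ∷ xs) f g = trans (cong (f x + g x +_) (∑-+ xs f g))
  (solve 4 (λ a b c d → a :+ b :+ (c :+ d) := a :+ c :+ (b :+ d)) refl (f x) (g x) (∑ xs f) (∑ xs g))
  where open +-*-Solver

∑-cartesianProductWith : ∀ (h : X → Y → Z) xs ys (f : Z → ℕ) →
  ∑ (cartesianProductWith h xs ys) f ≡ ∑ xs (λ x → ∑ ys (f ∘ h x))
∑-cartesianProductWith h []       ys f = refl
∑-cartesianProductWith h (x ∷ xs) ys f = trans (∑-++ (map (h x) ys) _ f)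
  (cong₂ _+_ (cong sum (sym (map-∘ ys))) (∑-cartesianProductWith h xs ys f))

∑-allVecs : ∀ n (f : Vec Bool (suc n) → ℕ) →
  ∑ (allVecs (suc n)) f ≡ ∑ (allVecs n) (λ v → f (true ∷ v) + f (false ∷ v))
∑-allVecs n f = go (allVecs n)
  where
  go : ∀ vs → ∑ (concatMap (λ v → (true ∷ v) ∷ (false ∷ v) ∷ []) vs) f ≡
              ∑ vs (λ v → f (true ∷ v) + f (false ∷ v))
  go []       = refl
  go (v ∷ vs) = trans (cong (λ m → f (true ∷ v) + (f (false ∷ v) + m)) (go vs)) (sym (+-assoc (f (true ∷ v)) _ _))

-- Flipping the first bit exchanges the two summands belonging to each tail; flipping a later bit
-- acts on the tails alone.
∑-allVecs-updateAt : ∀ n (i : Fin n) (f : Vec Bool n → ℕ) →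
  ∑ (allVecs n) (λ v → f (updateAt v i not)) ≡ ∑ (allVecs n) f
∑-allVecs-updateAt (suc n) zero f = trans (∑-allVecs n _)
  (trans (∑-cong (allVecs n) (λ v → +-comm (f (false ∷ v)) _)) (sym (∑-allVecs n f)))
∑-allVecs-updateAt (suc n) (suc i) f = trans (∑-allVecs n _)
  (trans (∑-allVecs-updateAt n i (λ v → f (true ∷ v) + f (false ∷ v))) (sym (∑-allVecs n f)))

∑-allTours-flipEdge : ∀ (i j : Fin n) (f : Tour n → ℕ) →
  ∑ (allTours n) (f ∘ flipEdge i j) ≡ ∑ (allTours n) f
∑-allTours-flipEdge {suc n} zero    zero    f = refl
∑-allTours-flipEdge {suc n} zero    (suc j) f = trans (∑-cartesianProductWith _,_ (allTours n) _ _)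
  (trans (∑-cong (allTours n) (λ t → ∑-allVecs-updateAt n j (λ v → f (t , v))))
    (sym (∑-cartesianProductWith _,_ (allTours n) _ f)))
∑-allTours-flipEdge {suc n} (suc i) zero    f = trans (∑-cartesianProductWith _,_ (allTours n) _ _)
  (trans (∑-cong (allTours n) (λ t → ∑-allVecs-updateAt n i (λ v → f (t , v))))
    (sym (∑-cartesianProductWith _,_ (allTours n) _ f)))
∑-allTours-flipEdge {suc n} (suc i) (suc j) f = trans (∑-cartesianProductWith _,_ (allTours n) _ _)
  (trans (∑-allTours-flipEdge i j (λ t → ∑ (allVecs n) (λ v → f (t , v))))
    (sym (∑-cartesianProductWith _,_ (allTours n) _ f)))

𝟙 : Bool → ℕ
𝟙 false = 0
𝟙 true  = 1

length-filterᵇ : ∀ (p : X → Bool) xs → length (filterᵇ p xs) ≡ ∑ xs (𝟙 ∘ p)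
length-filterᵇ p []       = refl
length-filterᵇ p (x ∷ xs) with p x
... | true  = cong suc (length-filterᵇ p xs)
... | false = length-filterᵇ p xs

count : (Tour n → Bool) → ℕ
count {n} p = ∑ (allTours n) (𝟙 ∘ p)

count-true : count {n} (λ _ → true) ≡ total n
count-true {n} = go (allTours n)
  where
  go : ∀ (xs : List X) → ∑ xs (λ _ → 1) ≡ length xs
  go []       = refl
  go (x ∷ xs) = cong suc (go xs)

count-split : ∀ (p q : Tour n → Bool) →
  count p ≡ count (λ t → p t ∧ q t) + count (λ t → p t ∧ not (q t))
count-split {n} p q = trans (∑-cong (allTours n) (λ t → split (p t) (q t)))
  (∑-+ (allTours n) (λ t → 𝟙 (p t ∧ q t)) (λ t → 𝟙 (p t ∧ not (q t))))
  where
  split : ∀ a b → 𝟙 a ≡ 𝟙 (a ∧ b) + 𝟙 (a ∧ not b)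
  split false _     = refl
  split true  false = refl
  split true  true  = refl

FlipInvariant : (Tour n → Bool) → Fin n → Fin n → Set
FlipInvariant p i j = ∀ t → p (flipEdge i j t) ≡ p t

-- Flipping the edge carries the tournaments in `p` with `i → j` bijectively to those in `p` with
-- the opposite orientation.
count-edge : ∀ (p : Tour n → Bool) {i j} → i ≢ j → FlipInvariant p i j →
  count (λ t → p t ∧ edge t i j) ≡ count (λ t → p t ∧ not (edge t i j))
count-edge p {i} {j} i≢j inv = sym (trans
  (∑-cong (allTours _) (λ t → cong 𝟙 (sym (cong₂ _∧_ (inv t) (edge-flipEdge t i≢j)))))
  (∑-allTours-flipEdge i j (λ t → 𝟙 (p t ∧ edge t i j))))

2*count-edge : ∀ (p : Tour n → Bool) {i j} → i ≢ j → FlipInvariant p i j →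
  2 * count (λ t → p t ∧ edge t i j) ≡ count p
2*count-edge p {i} {j} i≢j inv = trans
  (cong (count (λ t → p t ∧ edge t i j) +_) (trans (+-identityʳ _) (count-edge p i≢j inv)))
  (sym (count-split p (λ t → edge t i j)))

-- Avoiding families of edge-disjoint triples

Triple : ℕ → Set
Triple n = Fin n × Fin n × Fin n

traversed : Triple n → Tour n → Bool
traversed (x , z , y) t = edge t x z ∧ edge t z y

NonDegenerate : Triple n → Set
NonDegenerate (x , z , y) = x ≢ z × z ≢ y × x ≢ y

Independent : Triple n → Triple n → Set
Independent (x , z , y) (x′ , z′ , y′) =
  (DistinctEdges x z x′ z′ × DistinctEdges x z z′ y′) ×
  (DistinctEdges z y x′ z′ × DistinctEdges z y z′ y′)

-- Each of the two edges halves the count, so a quarter of `p` traverses the triple and three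
-- quarters remain. Adding `4 * a` to both sides avoids subtraction.
count-¬traversed : ∀ (p : Tour n → Bool) (τ : Triple n) → let x , z , y = τ in NonDegenerate τ →
  FlipInvariant p x z → FlipInvariant p z y →
  4 * count (λ t → p t ∧ not (traversed τ t)) ≡ 3 * count p
count-¬traversed p τ@(x , z , y) (x≢z , z≢y , x≢y) inv₁ inv₂ = +-cancelˡ-≡ (4 * a) _ _ (begin
  4 * a + 4 * b  ≡⟨ *-distribˡ-+ 4 a b ⟨
  4 * (a + b)    ≡⟨ cong (4 *_) (count-split p (traversed τ)) ⟨
  4 * c          ≡⟨⟩
  c + 3 * c      ≡⟨ cong (_+ 3 * c) 4a≡c ⟨
  4 * a + 3 * c  ∎)
  where
  open ≡-Reasoning
  a = count (λ t → p t ∧ traversed τ t)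
  b = count (λ t → p t ∧ not (traversed τ t))
  c = count p
  p₁ : Tour _ → Bool
  p₁ t = p t ∧ edge t x z
  4a≡c : 4 * a ≡ c
  4a≡c = begin
    4 * a              ≡⟨ *-assoc 2 2 a ⟩
    2 * (2 * a)        ≡⟨ cong (λ m → 2 * (2 * m)) (∑-cong (allTours _) (λ t → cong 𝟙 (sym (∧-assoc (p t) _ _)))) ⟩
    2 * (2 * count (λ t → p₁ t ∧ edge t z y))
                       -- The second halving needs the event `p₁`, which already fixes the edge
                       -- `x z`, to be unaffected by flipping `z y`; the two edges differ because
                       -- the triple is nondegenerate.
                       ≡⟨ cong (2 *_) (2*count-edge p₁ z≢y λ t → cong₂ _∧_ (inv₂ t)
                            (edge-flipEdge-minimal t ((λ (e , _) → x≢z e) , λ (e , _) → x≢y e))) ⟩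
    2 * count p₁       ≡⟨ 2*count-edge p x≢z inv₁ ⟩
    c                  ∎

avoids : List (Triple n) → Tour n → Bool
avoids []       t = true
avoids (τ ∷ τs) t = avoids τs t ∧ not (traversed τ t)

avoids-flipInvariant : ∀ {i j : Fin n} τs →
  All (λ (x , z , y) → DistinctEdges i j x z × DistinctEdges i j z y) τs → FlipInvariant (avoids τs) i j
avoids-flipInvariant []       []              t = refl
avoids-flipInvariant (τ ∷ τs) ((d₁ , d₂) ∷ ds) t = cong₂ (λ a b → a ∧ not b) (avoids-flipInvariant τs ds t)
  (cong₂ _∧_ (edge-flipEdge-minimal t d₁) (edge-flipEdge-minimal t d₂))

-- Avoiding `τs` reads only edges different from those of the next triple, hence is invariant under
-- flipping them, and each triple contributes a factor of exactly 3/4.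
count-avoids : ∀ (τs : List (Triple n)) → All NonDegenerate τs → AllPairs Independent τs →
  4 ^ length τs * count (avoids τs) ≡ 3 ^ length τs * total n
count-avoids {n} []       []         []         = cong (1 *_) (count-true {n})
count-avoids {n} (τ ∷ τs) (nd ∷ nds) (ind ∷ inds) = begin
  4 * 4 ^ l * count (avoids (τ ∷ τs))   ≡⟨ solve 2 (λ a b → con 4 :* a :* b := a :* (con 4 :* b)) refl (4 ^ l) (count (avoids (τ ∷ τs))) ⟩
  4 ^ l * (4 * count (avoids (τ ∷ τs))) ≡⟨ cong (4 ^ l *_) (count-¬traversed (avoids τs) τ nd
                                             (avoids-flipInvariant τs (All.map proj₁ ind))
                                             (avoids-flipInvariant τs (All.map proj₂ ind))) ⟩
  4 ^ l * (3 * count (avoids τs))       ≡⟨ solve 2 (λ a b → a :* (con 3 :* b) := con 3 :* (a :* b)) refl (4 ^ l) (count (avoids τs)) ⟩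
  3 * (4 ^ l * count (avoids τs))       ≡⟨ cong (3 *_) (count-avoids τs nds inds) ⟩
  3 * (3 ^ l * total n)                 ≡⟨ *-assoc 3 (3 ^ l) (total n) ⟨
  3 * 3 ^ l * total n                   ∎
  where
  open ≡-Reasoning
  open +-*-Solver
  l = length τs

-- The union bound over configurations

length-cartesianProductWith : ∀ (f : X → Y → Z) xs ys →
  length (cartesianProductWith f xs ys) ≡ length xs * length ys
length-cartesianProductWith f []       ys = refl
length-cartesianProductWith f (x ∷ xs) ys = trans (length-++ (map (f x) ys))
  (cong₂ _+_ (length-map (f x) ys) (length-cartesianProductWith f xs ys))

Unique-⊆-length : ∀ {xs ys : List X} → Unique xs → (∀ {v} → v ∈ xs → v ∈ ys) → length xs ≤ length ys
Unique-⊆-length []                             _  = z≤n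
Unique-⊆-length {xs = x ∷ xs} (x∉xs ∷ uniq) xs⊆ with ∈-∃++ (xs⊆ (here refl))
... | as , bs , refl = ≤-trans (s≤s (Unique-⊆-length uniq xs⊆′)) (≤-reflexive (begin
  suc (length (as ++ bs))        ≡⟨ cong suc (length-++ as) ⟩
  suc (length as + length bs)    ≡⟨ +-suc (length as) (length bs) ⟨
  length as + suc (length bs)    ≡⟨ length-++ as ⟨
  length (as ++ x ∷ bs)          ∎))
  where
  open ≡-Reasoning
  xs⊆′ : ∀ {v} → v ∈ xs → v ∈ as ++ bs
  xs⊆′ v∈ with ∈-++⁻ as (xs⊆ (there v∈))
  ... | inj₁ v∈as         = ∈-++⁺ˡ v∈as
  ... | inj₂ (here refl)  = contradiction refl (All.lookup x∉xs v∈)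
  ... | inj₂ (there v∈bs) = ∈-++⁺ʳ as v∈bs

-- Only an inequality, because `xs` may have repeated entries; it holds since `others xs ++ xs`
-- covers all vertices.
length-others : ∀ (xs : List (Fin n)) → n ≤ length (others xs) + length xs
length-others {n} xs = subst₂ _≤_ (length-tabulate {n = n} (λ i → i)) (length-++ (others xs))
  (Unique-⊆-length (Unique.allFin⁺ n) λ {v} _ → cover v)
  where
  cover : ∀ v → v ∈ others xs ++ xs
  cover v with v ∈? xs
  ... | yes v∈ = ∈-++⁺ʳ (others xs) v∈
  ... | no  v∉ = ∈-++⁺ˡ (∈-others⁺ v∉)

length-pairs : ∀ (xs : List X) → length (pairs xs) ≡ ⌊ length xs /2⌋
length-pairs []           = refl
length-pairs (x ∷ [])     = refl
length-pairs (x ∷ y ∷ xs) = cong suc (length-pairs xs)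

∈-pairs⇒∈ : ∀ (xs : List X) {x y} → (x , y) ∈ pairs xs → x ∈ xs × y ∈ xs
∈-pairs⇒∈ (x ∷ y ∷ xs) (here refl) = here refl , there (here refl)
∈-pairs⇒∈ (x ∷ y ∷ xs) (there p) with ∈-pairs⇒∈ xs p
... | x∈ , y∈ = there (there x∈) , there (there y∈)

pairs-distinct : ∀ {xs : List X} → Unique xs → ∀ {x y} → (x , y) ∈ pairs xs → x ≢ y
pairs-distinct {xs = x ∷ y ∷ xs} (x∉ ∷ _) (here refl) = All.head x∉
pairs-distinct {xs = x ∷ y ∷ xs} (_ ∷ (_ ∷ uniq)) (there p) = pairs-distinct uniq p

DisjointPairs : X × X → X × X → Set
DisjointPairs (x , y) (x′ , y′) = (x ≢ x′ × x ≢ y′) × (y ≢ x′ × y ≢ y′)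

pairs-disjoint : ∀ {xs : List X} → Unique xs → AllPairs DisjointPairs (pairs xs)
pairs-disjoint {xs = []}         _ = []
pairs-disjoint {xs = x ∷ []}     _ = []
pairs-disjoint {xs = x ∷ y ∷ xs} ((_ ∷ x∉) ∷ (y∉ ∷ uniq)) =
  All.tabulate (λ p → let x′∈ , y′∈ = ∈-pairs⇒∈ xs p in
    (All.lookup x∉ x′∈ , All.lookup x∉ y′∈) , (All.lookup y∉ x′∈ , All.lookup y∉ y′∈))
  ∷ pairs-disjoint uniq

triple : Fin n → Fin n × Fin n → Triple n
triple z (x , y) = x , z , y

triples : List (Fin n) → List (Fin n) → List (Triple n)
triples L S = cartesianProductWith triple S (pairs L)

triples-nonDegenerate : ∀ {L S : List (Fin n)} → Unique L → All (_∉ L) S → All NonDegenerate (triples L S)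
triples-nonDegenerate {L = L} {S} uniq S∉L = All.tabulate nd
  where
  nd : ∀ {τ} → τ ∈ triples L S → NonDegenerate τ
  nd τ∈ with ∈-cartesianProductWith⁻ triple S (pairs L) τ∈
  ... | z , (x , y) , z∈ , xy∈ , refl with ∈-pairs⇒∈ L xy∈
  ...   | x∈ , y∈ = (λ { refl → All.lookup S∉L z∈ x∈ }) , (λ { refl → All.lookup S∉L z∈ y∈ }) ,
    pairs-distinct uniq xy∈

-- Every edge used joins a vertex of `S` to one of `L`. Triples with different middle vertices thus
-- have different edges, and those with the same middle vertex come from disjoint pairs.
triples-independent : ∀ {L S : List (Fin n)} → Unique L → Unique S → All (_∉ L) S →
  AllPairs Independent (triples L S)
triples-independent {L = L} uniqL []             []        = []
triples-independent {L = L} {z ∷ S} uniqL (z∉S ∷ uniqS) (z∉L ∷ S∉L) =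
  AllPairs.++⁺
    (AllPairs.map⁺ (pairs-independent (pairs L) (λ p → p) (pairs-disjoint uniqL)))
    (triples-independent uniqL uniqS S∉L)
    (All.map⁺ (All.tabulate λ _ → All.tabulate separate))
  where
  independent : ∀ {x y x′ z′ y′} → x′ ≢ z → y′ ≢ z →
    (z′ ≡ z → (x ≢ x′ × x ≢ y′) × (y ≢ x′ × y ≢ y′)) → Independent (x , z , y) (x′ , z′ , y′)
  independent x′≢z y′≢z d =
    (((λ { (refl , e) → proj₁ (proj₁ (d e)) refl }) , (λ (e , _) → x′≢z e)) ,
     ((λ (_ , e) → y′≢z e) , (λ { (e , refl) → proj₂ (proj₁ (d e)) refl }))) ,
    (((λ (e , _) → x′≢z e) , (λ { (refl , e) → proj₁ (proj₂ (d e)) refl })) ,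
     ((λ { (e , refl) → proj₂ (proj₂ (d e)) refl }) , (λ (_ , e) → y′≢z e)))

  ≢z : ∀ {x y} → (x , y) ∈ pairs L → x ≢ z × y ≢ z
  ≢z p with ∈-pairs⇒∈ L p
  ... | x∈ , y∈ = (λ { refl → z∉L x∈ }) , (λ { refl → z∉L y∈ })

  pairs-independent : ∀ ps → (∀ {p} → p ∈ ps → p ∈ pairs L) → AllPairs DisjointPairs ps →
    AllPairs (λ p p′ → Independent (triple z p) (triple z p′)) ps
  pairs-independent []       _  []       = []
  pairs-independent (p ∷ ps) ps⊆ (d ∷ ds) =
    All.tabulate (λ {p′} p′∈ → let x′≢z , y′≢z = ≢z (ps⊆ (there p′∈)) in
      independent x′≢z y′≢z (λ _ → All.lookup d p′∈))
    ∷ pairs-independent ps (ps⊆ ∘ there) ds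

  separate : ∀ {p τ} → τ ∈ triples L S → Independent (triple z p) τ
  separate τ∈ with ∈-cartesianProductWith⁻ triple S (pairs L) τ∈
  ... | z′ , p′ , z′∈ , p′∈ , refl = let x′≢z , y′≢z = ≢z p′∈ in
    independent x′≢z y′≢z (λ { refl → contradiction refl (All.lookup z∉S z′∈) })

-- Enumerating configurations and summing their failure counts

words : ℕ → List (List (Fin n))
words zero    = [] ∷ []
words (suc m) = cartesianProductWith _∷_ (allFin _) (words m)

∈-words : ∀ (xs : List (Fin n)) → xs ∈ words (length xs)
∈-words []       = here refl
∈-words (x ∷ xs) = ∈-cartesianProductWith⁺ _∷_ (∈-allFin x) (∈-words xs)

length-words : ∀ m → length (words {n} m) ≡ n ^ m
length-words     zero    = refl
length-words {n} (suc m) = trans (length-cartesianProductWith _∷_ (allFin n) (words m))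
  (cong₂ _*_ (length-tabulate {n = n} (λ i → i)) (length-words {n} m))

Config : ℕ → Set
Config n = List (Fin n) × List (Fin n)

Good : ℕ → Config n → Set
Good K (L , S) = Unique L × Unique S × All (_∉ L) S × K ≤ length (triples L S)

good? : ∀ K (c : Config n) → Dec (Good K c)
good? K (L , S) = DecUnique.unique? _≟ᶠ_ L ×-dec DecUnique.unique? _≟ᶠ_ S ×-dec
                  all? (_∉? L) S ×-dec K ≤? length (triples L S)

detourConfig : List (Fin n) → Config n
detourConfig w = take 2 w , others w

insertionConfig : ℕ → List (Fin n) → Config n
insertionConfig t w = take t w , drop t w

-- A vertex list w encodes either a pair (its first two entries) with all vertices outside w, or t
-- path vertices followed by the vertices to be inserted.
configs : ℕ → ℕ → List (Config n)
configs t s = map detourConfig (words (2 + t)) ++ map (insertionConfig t) (words (t + s))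

length-configs : ∀ t s → length (configs {n} t s) ≡ n ^ (2 + t) + n ^ (t + s)
length-configs {n} t s = trans (length-++ (map detourConfig (words {n} (2 + t))))
  (cong₂ _+_ (trans (length-map detourConfig (words {n} (2 + t))) (length-words {n} (2 + t)))
             (trans (length-map (insertionConfig t) (words {n} (t + s))) (length-words {n} (t + s))))

hits : List (Config n) → Tour n → Bool
hits []            t = true
hits ((L , S) ∷ C) t = hits C t ∧ not (avoids (triples L S) t)

avoids-false : ∀ (τs : List (Triple n)) t → avoids τs t ≡ false → ∃ λ τ → τ ∈ τs × traversed τ t ≡ true
avoids-false (τ ∷ τs) t eq with traversed τ t in eqτ
... | true  = τ , here refl , eqτ
... | false with avoids τs t in eqs
...   | false with avoids-false τs t eqs
...     | σ , σ∈ , eqσ = σ , there σ∈ , eqσ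

hits⇒¬avoids : ∀ {C : List (Config n)} {t L S} → hits C t ≡ true → (L , S) ∈ C → avoids (triples L S) t ≡ false
hits⇒¬avoids {C = (L , S) ∷ C} {t} eq c∈ with hits C t in eqC | avoids (triples L S) t in eqA | c∈
... | true | false | here refl = eqA
... | true | false | there c∈′ = hits⇒¬avoids {C = C} eqC c∈′

hits⇒insertion : ∀ {C : List (Config n)} {t L S} → hits C t ≡ true → (L , S) ∈ C →
  ∃ λ z → z ∈ S × ∃₂ λ x y → (x , y) ∈ pairs L × arc t x z × arc t z y
hits⇒insertion {t = t} {L} {S} eq c∈ with avoids-false (triples L S) t (hits⇒¬avoids eq c∈)
... | τ , τ∈ , eqτ with ∈-cartesianProductWith⁻ triple S (pairs L) τ∈
...   | z , (x , y) , z∈ , xy∈ , refl with edge t x z in e₁ | edge t z y in e₂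
...     | true | true = z , z∈ , x , y , xy∈ , edge⇒arc t x z e₁ , edge⇒arc t z y e₂

count-mono : ∀ {p q : Tour n → Bool} → (∀ t → 𝟙 (p t) ≤ 𝟙 (q t)) → count p ≤ count q
count-mono {n} {p} {q} p≤q = go (allTours n)
  where
  go : ∀ ts → ∑ ts (𝟙 ∘ p) ≤ ∑ ts (𝟙 ∘ q)
  go []       = z≤n
  go (t ∷ ts) = +-mono-≤ (p≤q t) (go ts)

-- The union bound in additive form: the tournaments that hit `C` but fail at the next configuration
-- are at most all those avoiding its triples.
total≤count-hits : ∀ (C : List (Config n)) →
  total n ≤ ∑ C (count ∘ avoids ∘ uncurry triples) + count (hits C)
total≤count-hits {n} []            = ≤-reflexive (sym (count-true {n}))
total≤count-hits {n} ((L , S) ∷ C) = begin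
  total n                                        ≤⟨ total≤count-hits C ⟩
  Σ′ + count (hits C)                            ≡⟨ cong (Σ′ +_) (count-split (hits C) (avoids (triples L S))) ⟩
  Σ′ + (count (λ t → hits C t ∧ avoids (triples L S) t) + h)
    ≤⟨ +-monoʳ-≤ Σ′ (+-monoˡ-≤ h (count-mono {p = λ t → hits C t ∧ avoids (triples L S) t}
         (λ t → ∧-≤ (hits C t) (avoids (triples L S) t)))) ⟩
  Σ′ + (a + h)                                   ≡⟨ solve 3 (λ u v w → u :+ (v :+ w) := v :+ u :+ w) refl Σ′ a h ⟩
  a + Σ′ + h                                     ∎
  where
  open ≤-Reasoning
  open +-*-Solver
  Σ′ = ∑ C (count ∘ avoids ∘ uncurry triples)
  a = count (avoids (triples L S))
  h = count (hits ((L , S) ∷ C))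
  ∧-≤ : ∀ u v → 𝟙 (u ∧ v) ≤ 𝟙 v
  ∧-≤ false v = z≤n
  ∧-≤ true  v = ≤-refl

-- The exact count has exponent `length τs`, which may exceed `K`; the surplus `d` is discarded by
-- `3 ^ d ≤ 4 ^ d`.
count-avoids-good : ∀ K {c : Config n} → Good K c →
  4 ^ K * count (avoids (uncurry triples c)) ≤ 3 ^ K * total n
count-avoids-good {n} K {L , S} (uniqL , uniqS , S∉L , K≤l) = *-cancelʳ-≤ _ _ (4 ^ d) {{m^n≢0 4 d}} (begin
  4 ^ K * c * 4 ^ d           ≡⟨ solve 3 (λ u v w → u :* v :* w := u :* w :* v) refl (4 ^ K) c (4 ^ d) ⟩
  4 ^ K * 4 ^ d * c           ≡⟨ cong (_* c) (^-distribˡ-+-* 4 K d) ⟨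
  4 ^ (K + d) * c             ≡⟨ cong (λ l → 4 ^ l * c) (m+[n∸m]≡n K≤l) ⟩
  4 ^ length τs * c           ≡⟨ count-avoids τs (triples-nonDegenerate uniqL S∉L) (triples-independent uniqL uniqS S∉L) ⟩
  3 ^ length τs * total n     ≡⟨ cong (λ l → 3 ^ l * total n) (m+[n∸m]≡n K≤l) ⟨
  3 ^ (K + d) * total n       ≡⟨ cong (_* total n) (^-distribˡ-+-* 3 K d) ⟩
  3 ^ K * 3 ^ d * total n     ≤⟨ *-monoˡ-≤ (total n) (*-monoʳ-≤ (3 ^ K) (^-monoˡ-≤ d (n≤1+n 3))) ⟩
  3 ^ K * 4 ^ d * total n     ≡⟨ solve 3 (λ u v w → u :* v :* w := u :* w :* v) refl (3 ^ K) (4 ^ d) (total n) ⟩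
  3 ^ K * total n * 4 ^ d     ∎)
  where
  open ≤-Reasoning
  open +-*-Solver
  τs = triples L S
  c = count (avoids τs)
  d = length τs ∸ K

∑-avoids : ∀ K {C : List (Config n)} → All (Good K) C →
  4 ^ K * ∑ C (count ∘ avoids ∘ uncurry triples) ≤ length C * (3 ^ K * total n)
∑-avoids K []                = ≤-reflexive (*-zeroʳ (4 ^ K))
∑-avoids K {c ∷ C} (g ∷ gs) = ≤-trans
  (≤-reflexive (*-distribˡ-+ (4 ^ K) (count (avoids (uncurry triples c))) _))
  (+-mono-≤ (count-avoids-good K g) (∑-avoids K gs))

-- From 2 + 2s excluded vertices at least s² candidates for a detour must remain.
size : ℕ → ℕ
size s = s * s + (2 + (s + s))

-- Filtering makes the (3/4)^(s²) bound valid for every remaining configuration, while their number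
-- is still bounded by the number of words.
selected : ℕ → List (Config n)
selected s = filter (good? (s * s)) (configs (s + s) s)

-- Detours and insertions from hit configurations

module _ {s : ℕ} {t : Tour n} (eq : hits (selected s) t ≡ true) where

  hits⇒HasDetours : size s ≤ n → HasDetours (arc t) (s + s)
  hits⇒HasDetours n≥ {x} {y} Z x≢y Z≤ = detour
    (hits⇒insertion eq (∈-filter⁺ (good? (s * s)) config∈
      ((x≢y ∷ []) ∷ [] ∷ [] , others-Unique w , All.tabulate outside , enough)))
    where
    -- `Z` is padded to length exactly `s + s`. Copies of `x` exclude no further vertex.
    w = x ∷ y ∷ Z ++ replicate (s + s ∸ length Z) x

    length-w : length w ≡ 2 + (s + s)
    length-w = cong (2 +_) (trans (length-++ Z)
      (trans (cong (length Z +_) (length-replicate (s + s ∸ length Z))) (m+[n∸m]≡n Z≤)))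

    config∈ : (x ∷ y ∷ [] , others w) ∈ configs (s + s) s
    config∈ = ∈-++⁺ˡ (∈-map⁺ _ (subst (λ m → w ∈ words m) length-w (∈-words w)))

    outside : ∀ {v} → v ∈ others w → v ∉ x ∷ y ∷ []
    outside v∈ (here refl)         = ∈-others⁻ v∈ (here refl)
    outside v∈ (there (here refl)) = ∈-others⁻ v∈ (there (here refl))

    -- There is a single pair, so the triples are as many as the vertices outside `w`, of which at
    -- least `n` minus `2 + (s + s)` exist.
    enough : s * s ≤ length (triples (x ∷ y ∷ []) (others w))
    enough = subst (s * s ≤_)
      (sym (trans (length-cartesianProductWith triple (others w) _) (*-identityʳ _)))
      (+-cancelʳ-≤ (2 + (s + s)) _ _ (≤-trans n≥
        (subst (λ m → n ≤ length (others w) + m) length-w (length-others w))))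

    detour : (∃ λ z → z ∈ others w × ∃₂ λ x′ y′ → (x′ , y′) ∈ (x , y) ∷ [] × arc t x′ z × arc t z y′) →
             ∃ λ z → z ∉ Z × arc t x z × arc t z y
    detour (z , z∈ , _ , _ , here refl , xz , zy) =
      z , (λ z∈Z → ∈-others⁻ z∈ (there (there (∈-++⁺ˡ z∈Z)))) , xz , zy

  hits⇒HasInsertions : HasInsertions (arc t) (s + s) s
  hits⇒HasInsertions L S lenL lenS uniqL uniqS S∉L =
    hits⇒insertion eq (∈-filter⁺ (good? (s * s)) config∈ (uniqL , uniqS , S∉L , ≤-reflexive enough))
    where
    config∈ : (L , S) ∈ configs (s + s) s
    config∈ = ∈-++⁺ʳ (map _ (words (2 + (s + s)))) (subst (_∈ map _ (words (s + s + s)))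
      (cong₂ _,_ (trans (cong (λ m → take m (L ++ S)) (sym lenL)) (take-length L))
                 (trans (cong (λ m → drop m (L ++ S)) (sym lenL)) (drop-length L)))
      (∈-map⁺ (insertionConfig (s + s))
        (subst (λ m → L ++ S ∈ words m) (trans (length-++ L) (cong₂ _+_ lenL lenS)) (∈-words (L ++ S)))))
      where
      take-length : ∀ (xs : List (Fin n)) {ys} → take (length xs) (xs ++ ys) ≡ xs
      take-length []       = refl
      take-length (x ∷ xs) = cong (x ∷_) (take-length xs)
      drop-length : ∀ (xs : List (Fin n)) {ys} → drop (length xs) (xs ++ ys) ≡ ys
      drop-length []       = refl
      drop-length (x ∷ xs) = drop-length xs

    -- The `s + s` vertices of `L` form `s` blocks, each combined with `s` middle vertices.
    enough : s * s ≡ length (triples L S)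
    enough = sym (trans (length-cartesianProductWith triple S (pairs L)) (cong₂ _*_ lenS
      (trans (length-pairs L) (trans (cong ⌊_/2⌋ lenL) (sym (n≡⌊n+n/2⌋ s))))))

hits⇒PathExtendable : ∀ {s} {t : Tour n} → size s ≤ n →
  hits (selected s) t ≡ true → PathExtendable (arc t)
hits⇒PathExtendable {s = s} {t} n≥ eq = path-extendable (arc-semicomplete t) (arc-asym t) (m≤m+n s s)
  (hits⇒HasDetours {s = s} eq n≥) (hits⇒HasInsertions {s = s} eq)

-- At most `m` configurations fail, each on a proportion of at most (3/4)^K; `bound` says that the
-- product is at most 1/k, cleared of denominators.
count-hits-bound : ∀ k s → k * (n ^ (2 + (s + s)) + n ^ (s + s + s)) * 3 ^ (s * s) ≤ 4 ^ (s * s) →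
  k * (total n ∸ count (hits (selected {n} s))) ≤ total n
count-hits-bound {n} k s bound = *-cancelˡ-≤ (4 ^ K) {{m^n≢0 4 K}} (begin
  4 ^ K * (k * (total n ∸ count (hits C)))     ≤⟨ *-monoʳ-≤ (4 ^ K) (*-monoʳ-≤ k (m≤n+o⇒m∸n≤o _ _ (subst (total n ≤_) (+-comm Σ′ _) (total≤count-hits C)))) ⟩
  4 ^ K * (k * Σ′)                             ≡⟨ solve 3 (λ u v w → u :* (v :* w) := v :* (u :* w)) refl (4 ^ K) k Σ′ ⟩
  k * (4 ^ K * Σ′)                             ≤⟨ *-monoʳ-≤ k (∑-avoids {n} K (All.all-filter (good? K) (configs (s + s) s))) ⟩
  k * (length C * (3 ^ K * total n))           ≤⟨ *-monoʳ-≤ k (*-monoˡ-≤ (3 ^ K * total n) length-C) ⟩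
  k * (m * (3 ^ K * total n))                  ≡⟨ solve 4 (λ u v w x → u :* (v :* (w :* x)) := u :* v :* w :* x) refl k m (3 ^ K) (total n) ⟩
  k * m * 3 ^ K * total n                      ≤⟨ *-monoˡ-≤ (total n) bound ⟩
  4 ^ K * total n                              ∎)
  where
  open ≤-Reasoning
  open +-*-Solver
  K = s * s
  C = selected {n} s
  Σ′ = ∑ C (count ∘ avoids ∘ uncurry triples)
  m = n ^ (2 + (s + s)) + n ^ (s + s + s)
  length-C : length C ≤ m
  length-C = ≤-trans (length-filter (good? K) (configs {n} (s + s) s)) (≤-reflexive (length-configs {n} (s + s) s))

-- The choice of s

binary-magnitude : ∀ n → 1 ≤ n → ∃ λ l → 2 ^ l ≤ n × n < 2 ^ suc l
binary-magnitude (suc zero)      _ = 0 , s≤s z≤n , s≤s (s≤s z≤n)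
binary-magnitude (suc n@(suc _)) _ with binary-magnitude n (s≤s z≤n)
... | l , l≤ , <l with suc n <? 2 ^ suc l
...   | yes p = l , m≤n⇒m≤1+n l≤ , p
...   | no ¬p = suc l , ≮⇒≥ ¬p , ≤-<-trans <l (^-monoʳ-< 2 (s≤s (s≤s z≤n)) (n<1+n (suc l)))

n<2^n : ∀ n → n < 2 ^ n
n<2^n zero    = s≤s z≤n
n<2^n (suc n) = ≤-trans (s≤s (n<2^n n))
  (subst (suc (2 ^ n) ≤_) (cong (2 ^ n +_) (sym (+-identityʳ _))) (+-monoˡ-≤ (2 ^ n) (m^n>0 2 n)))

-- Raising `s` by 12 matches one doubling of the bound. The excess `22 * s + 166` is at most
-- `30 * s`, hence at most `s * s`, once `s` is at least 30.
size-step : ∀ s b → 30 ≤ s → size s ≤ b → size (12 + s) ≤ 2 * b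
size-step s b 30≤s ≤b = ≤-trans (+-cancelʳ-≤ (s * s) _ _ (begin
  size (12 + s) + s * s         ≡⟨ solve 1 (λ s → (con 12 :+ s) :* (con 12 :+ s) :+ (con 2 :+ ((con 12 :+ s) :+ (con 12 :+ s))) :+ s :* s
                                     := con 2 :* (s :* s :+ (con 2 :+ (s :+ s))) :+ (con 22 :* s :+ con 166)) refl s ⟩
  2 * size s + (22 * s + 166)   ≤⟨ +-monoʳ-≤ (2 * size s) (+-monoʳ-≤ (22 * s) (≤-trans (from-yes (166 ≤? 8 * 30)) (*-monoʳ-≤ 8 30≤s))) ⟩
  2 * size s + (22 * s + 8 * s) ≡⟨ cong (2 * size s +_) (*-distribʳ-+ s 22 8) ⟨
  2 * size s + 30 * s           ≤⟨ +-monoʳ-≤ (2 * size s) (*-monoˡ-≤ s 30≤s) ⟩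
  2 * size s + s * s            ∎)) (*-monoʳ-≤ 2 ≤b)
  where
  open ≤-Reasoning
  open +-*-Solver

-- With `l = d + 16` this bounds `size (12 (l + 1))` by `2 ^ l`. The base case is 42026 ≤ 65536; for
-- `l = 15` the inequality fails.
size≤2^ : ∀ d → size ((d + 17) * 12) ≤ 2 ^ (d + 16)
size≤2^ zero    = from-yes (size (17 * 12) ≤? 2 ^ 16)
size≤2^ (suc d) = size-step ((d + 17) * 12) (2 ^ (d + 16))
  (≤-trans (from-yes (30 ≤? 17 * 12)) (*-monoˡ-≤ 12 (m≤n+m 17 d))) (size≤2^ d)

-- By the two equations `s * s` is three times the exponent of 2, so the claim is the `m`-th power
-- of 2 · 27 ≤ 64.
power-bound : ∀ m ℓ s → ℓ * (4 * s) ≡ m → s * s ≡ 3 * m →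
              2 ^ (ℓ * (4 * s)) * 3 ^ (s * s) ≤ 4 ^ (s * s)
power-bound m ℓ s eq₁ eq₂ = begin
  2 ^ (ℓ * (4 * s)) * 3 ^ (s * s)  ≡⟨ cong₂ (λ a b → 2 ^ a * 3 ^ b) eq₁ eq₂ ⟩
  2 ^ m * 3 ^ (3 * m)              ≡⟨ cong (2 ^ m *_) (^-*-assoc 3 3 m) ⟨
  2 ^ m * 27 ^ m                   ≡⟨ ^-distribʳ-* m 2 27 ⟨
  54 ^ m                           ≤⟨ ^-monoˡ-≤ m (from-yes (54 ≤? 64)) ⟩
  64 ^ m                           ≡⟨ ^-*-assoc 4 3 m ⟩
  4 ^ (3 * m)                      ≡⟨ cong (4 ^_) eq₂ ⟨
  4 ^ (s * s)                      ∎
  where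
  open ≤-Reasoning
  open +-*-Solver
  ^-distribʳ-* : ∀ m a b → (a * b) ^ m ≡ a ^ m * b ^ m
  ^-distribʳ-* zero    a b = refl
  ^-distribʳ-* (suc m) a b = trans (cong (a * b *_) (^-distribʳ-* m a b))
    (solve 4 (λ a b c d → a :* b :* (c :* d) := a :* c :* (b :* d)) refl a b (a ^ m) (b ^ m))

-- Both exponents of `n` are at most 3s. Merging the two powers costs a factor 2, which with `k`
-- gives `2 ^ suc l`; this accounts for the 1 in `1 + (s + s + s)`, which is at most 4s.
union-bound : ∀ k n l s → k ≤ 2 ^ l → 1 ≤ n → n ≤ 2 ^ suc l → 2 ≤ s →
  k * (n ^ (2 + (s + s)) + n ^ (s + s + s)) ≤ 2 ^ (suc l * (4 * s))
union-bound k n l s k≤ n≥1 n≤ 2≤s = begin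
  k * (n ^ (2 + (s + s)) + n ^ (s + s + s))
    ≤⟨ *-mono-≤ k≤ (+-monoˡ-≤ (n ^ (s + s + s)) (^-monoʳ-≤ n {{>-nonZero n≥1}} exponent)) ⟩
  2 ^ l * (n ^ (s + s + s) + n ^ (s + s + s))
    ≡⟨ solve 2 (λ a b → a :* (b :+ b) := con 2 :* a :* b) refl (2 ^ l) (n ^ (s + s + s)) ⟩
  2 ^ suc l * n ^ (s + s + s)
    ≤⟨ *-monoʳ-≤ (2 ^ suc l) (^-monoˡ-≤ (s + s + s) n≤) ⟩
  2 ^ suc l * (2 ^ suc l) ^ (s + s + s)
    ≡⟨ ^-*-assoc 2 (suc l) (1 + (s + s + s)) ⟩
  2 ^ (suc l * (1 + (s + s + s)))
    ≤⟨ ^-monoʳ-≤ 2 (*-monoʳ-≤ (suc l) (+-monoˡ-≤ (s + s + s) (<⇒≤ 2≤s))) ⟩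
  2 ^ (suc l * (s + (s + s + s)))
    ≡⟨ cong (λ a → 2 ^ (suc l * a)) (solve 1 (λ s → s :+ (s :+ s :+ s) := con 4 :* s) refl s) ⟩
  2 ^ (suc l * (4 * s)) ∎
  where
  open ≤-Reasoning
  open +-*-Solver
  exponent : 2 + (s + s) ≤ s + s + s
  exponent = ≤-trans (+-monoˡ-≤ (s + s) 2≤s) (≤-reflexive (+-comm s (s + s)))

parameters : ∀ k n → 2 ^ (k + 16) ≤ n → ∃ λ s → size s ≤ n ×
  k * (n ^ (2 + (s + s)) + n ^ (s + s + s)) * 3 ^ (s * s) ≤ 4 ^ (s * s)
parameters k n N≤n with binary-magnitude n (≤-trans (m^n>0 2 (k + 16)) N≤n)
... | l , 2^l≤n , n<2^1+l = s , size≤n ,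
  ≤-trans (*-monoˡ-≤ (3 ^ (s * s)) (union-bound k n l s k≤2^l (≤-trans (m^n>0 2 l) 2^l≤n) (<⇒≤ n<2^1+l) 2≤s))
    (power-bound (48 * (suc l * suc l)) (suc l) s
      (solve 1 (λ x → x :* (con 4 :* (x :* con 12)) := con 48 :* (x :* x)) refl (suc l))
      (solve 1 (λ x → x :* con 12 :* (x :* con 12) := con 3 :* (con 48 :* (x :* x))) refl (suc l)))
  where
  open +-*-Solver
  -- 2^(4ℓs) · 3^(s²) ≤ 4^(s²) for s = 12ℓ because 2 · 3³ ≤ 4³.
  s : ℕ
  s = suc l * 12
  2≤s : 2 ≤ s
  2≤s = s≤s (s≤s z≤n)
  k+16≤l : k + 16 ≤ l
  -- Otherwise `n < 2 ^ suc l ≤ 2 ^ (k + 16) ≤ n`. The summand `k` serves `k ≤ 2 ^ l`, and 16 serves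
  -- `size≤2^`.
  k+16≤l = ≮⇒≥ λ l< → <⇒≱ n<2^1+l (≤-trans (^-monoʳ-≤ 2 l<) N≤n)
  k≤2^l : k ≤ 2 ^ l
  k≤2^l = ≤-trans (<⇒≤ (n<2^n k)) (^-monoʳ-≤ 2 (≤-trans (m≤m+n k 16) k+16≤l))
  size≤n : size s ≤ n
  size≤n = ≤-trans (subst₂ (λ x y → size (x * 12) ≤ 2 ^ y)
    1+l≡ l≡ (size≤2^ (l ∸ 16))) 2^l≤n
    where
    l≡ : l ∸ 16 + 16 ≡ l
    l≡ = m∸n+n≡m (≤-trans (m≤n+m 16 k) k+16≤l)
    1+l≡ : l ∸ 16 + 17 ≡ suc l
    1+l≡ = trans (+-suc (l ∸ 16) 16) (cong suc l≡)

-- The limit is expressed by an arbitrary `k` and a threshold `N`. Path extendability is not a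
-- Boolean, so its probability is bounded below by that of a Boolean event implying it, here
-- `hits (selected s)`.
theorem11 : (k : ℕ) → Σ ℕ λ N → (n : ℕ) → N ≤ n →
    Σ (Tour n → Bool) λ sel →
    ((t : Tour n) → sel t ≡ true → PathExtendable (arc t)) ×
    (k * (total n ∸ countSel n sel) ≤ total n)
theorem11 k = 2 ^ (k + 16) , λ n N≤n →
  let s , size≤n , bound = parameters k n N≤n in
  hits (selected s) ,
  (λ t → hits⇒PathExtendable {s = s} size≤n) ,
  subst (λ c → k * (total n ∸ c) ≤ total n) (sym (length-filterᵇ (hits (selected s)) (allTours n)))
    (count-hits-bound {n} k s bound)
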